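{- For every integer $n\ge 5$ there exists an $(n^2,\lfloor n/2\rfloor)$-array that is not layerable.
   Context: $[n]=\{1,2,\dots,n\}$. For positive integers $n,d,k$, an $(n^d,k)$-array is a $d$-dimensional array of dimensions $n\times n\times\cdots\times n$ such that each entry is a subset of $[n]$ of cardinality exactly $k$, and every number in $[n]$ occurs in exactly $k$ of the entries along any axis-parallel line of the array (an axis-parallel line is the set of $n$ cells obtained by fixing all coordinates but one). A layer of an $(n^d,k)$-array is a choice of one element from the set in each cell such that each symbol of $[n]$ is chosen at most once (equivalently exactly once) along every axis-parallel line. The array is layerable if its entries can be partitioned into $k$ layers, i.e. there are $k$ layers such that every element of every cell's set is chosen in exactly one of them. -}

module Defs where

open import Data.Nat using (ℕ)
open import Data.Fin using (Fin)
open import Data.Fin.Subset using (Subset; _∈_; ∣_∣)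
open import Data.Product using (Σ; _×_; ∃!)
open import Data.Vec using (Vec; lookup; tabulate; _[_]≔_)
open import Function.Definitions using (Injective)
open import Relation.Binary.PropositionalEquality using (_≡_)

Cell : ℕ → ℕ → Set
Cell n d = Vec (Fin n) d

-- The axis-parallel line through c in direction i, as a parametrised
-- sequence of cells. Every cell of a line may serve as its base point c.
line : ∀ {n d} → Fin d → Cell n d → Fin n → Cell n d
line i c j = c [ i ]≔ j

-- The set of positions on a line whose entry contains the symbol s:
-- lookup p s is `inside` exactly when s ∈ p.
occurrences : ∀ {n d} → (Cell n d → Subset n) → Fin d → Cell n d → Fin n → Subset n
occurrences A i c s = tabulate λ j → lookup (A (line i c j)) s

record SetArray (n d k : ℕ) : Set where
  field
    entry      : Cell n d → Subset n
    entry-size : ∀ c → ∣ entry c ∣ ≡ k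
    line-count : ∀ i c s → ∣ occurrences entry i c s ∣ ≡ k

open SetArray public

record IsLayer {n d k : ℕ} (A : SetArray n d k) (L : Cell n d → Fin n) : Set where
  field
    chosen-from-entry : ∀ c → L c ∈ entry A c
    line-injective    : ∀ i c → Injective _≡_ _≡_ (λ j → L (line i c j))

Layerable : ∀ {n d k} → SetArray n d k → Set
Layerable {n} {d} {k} A =
  Σ (Fin k → Cell n d → Fin n) λ L →
    (∀ t → IsLayer A (L t)) ×
    (∀ c s → s ∈ entry A c → ∃! _≡_ λ t → L t c ≡ s)

{-# OPTIONS --safe #-}
module Submission where

-- View a set array as a 0/1 tensor T r c s with all line sums k. Split rows, columns and
-- symbols into two classes each, so that some of the eight blocks are empty. Counting in
-- a Latin square inside T then determines how often each row, column or symbol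
-- meets the remaining blocks, and T is chosen so that one of its entries lies in no Latin
-- square inside T at all.

open import Defs
open import Data.Bool using (Bool; true; false; not; _∧_; if_then_else_)
open import Data.Bool.Properties using (∧-identityʳ; ∧-zeroʳ)
open import Data.Empty using (⊥-elim)
open import Data.Fin using (Fin; zero; suc; toℕ; splitAt; _≟_)
open import Data.Fin.Properties using (any?; injective⇒≤; suc-injective; toℕ<n; +↔⊎)
open import Data.Fin.Subset using (∣_∣)
open import Data.Nat using (ℕ; zero; suc; _+_; _≤_; _≥_; _≡ᵇ_; _%_; ⌊_/2⌋; ⌈_/2⌉; s≤s)
open import Data.Nat.DivMod using ([m+n]%n≡m%n; m<n⇒m%n≡m)
open import Data.Nat.Properties using (+-comm; +-assoc; +-suc; +-identityʳ; +-cancelˡ-≡; 1+n≰n;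
  ⌊n/2⌋-mono; ⌊n/2⌋+⌈n/2⌉≡n)
  renaming (suc-injective to ℕ-suc-injective)
open import Data.Product using (Σ; ∃; _,_; proj₁; proj₂)
open import Data.Sum using (_⊎_; inj₁; inj₂; map)
open import Data.Sum.Properties using (inj₁-injective; inj₂-injective)
open import Data.Vec using (_∷_; []; tabulate)
open import Data.Vec.Properties using (lookup∘tabulate; tabulate-cong; lookup⇒[]=; []=⇒lookup)
open import Function using (_∘_; id; _↔_; Inverse)
open import Function.Definitions using (Injective)
open import Relation.Binary.PropositionalEquality
open import Relation.Nullary using (¬_; yes; no; does; contradiction)

-- Counting the true values of a Boolean function on `Fin n`.

⟦_⟧ : Bool → ℕ
⟦ b ⟧ = if b then 1 else 0

-- Opaque, so that unification solves for the counted function instead of unfolding the sum.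
opaque
  # : ∀ {n} → (Fin n → Bool) → ℕ
  # {zero}  f = 0
  # {suc n} f = ⟦ f zero ⟧ + # (f ∘ suc)

  #-suc : ∀ {n} (f : Fin (suc n) → Bool) → # f ≡ ⟦ f zero ⟧ + # (f ∘ suc)
  #-suc f = refl

  ∣tabulate∣ : ∀ {n} (f : Fin n → Bool) → ∣ tabulate f ∣ ≡ # f
  ∣tabulate∣ {zero}  f = refl
  ∣tabulate∣ {suc n} f with f zero
  ... | true  = cong suc (∣tabulate∣ (f ∘ suc))
  ... | false = ∣tabulate∣ (f ∘ suc)

  #-cong : ∀ {n} {f g : Fin n → Bool} → f ≗ g → # f ≡ # g
  #-cong {zero}  p = refl
  #-cong {suc n} p = cong₂ _+_ (cong ⟦_⟧ (p zero)) (#-cong (p ∘ suc))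

  #-true : ∀ n → # {n} (λ _ → true) ≡ n
  #-true zero    = refl
  #-true (suc n) = cong suc (#-true n)

  #-false : ∀ n → # {n} (λ _ → false) ≡ 0
  #-false zero    = refl
  #-false (suc n) = #-false n

  #-∧-true : ∀ {n} (f : Fin n → Bool) → # (λ i → f i ∧ true) ≡ # f
  #-∧-true f = #-cong (λ i → ∧-identityʳ (f i))

  #-∧-false : ∀ {n} (f : Fin n → Bool) → # (λ i → f i ∧ false) ≡ 0
  #-∧-false {n} f = trans (#-cong (λ i → ∧-zeroʳ (f i))) (#-false n)

  #-not : ∀ {n} (f : Fin n → Bool) → # (not ∘ f) + # f ≡ n
  #-not {zero}  f = refl
  #-not {suc n} f with f zero
  ... | true  = trans (+-suc (# (not ∘ f ∘ suc)) (# (f ∘ suc))) (cong suc (#-not (f ∘ suc)))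
  ... | false = cong suc (#-not (f ∘ suc))

  #-not-unique : ∀ {n} (f : Fin (suc n) → Bool) → # f ≡ 1 → # (not ∘ f) ≡ n
  #-not-unique {n} f e = ℕ-suc-injective
    (trans (sym (+-comm (# (not ∘ f)) 1)) (trans (cong (# (not ∘ f) +_) (sym e)) (#-not f)))

  #-≟ : ∀ {n} (i : Fin n) → # (λ j → does (i ≟ j)) ≡ 1
  #-≟ {suc n} zero    = cong suc (#-false n)
  #-≟ {suc n} (suc i) = #-≟ i

  #-∧-≟ : ∀ {n} (f : Fin n → Bool) (j : Fin n) → # (λ i → f i ∧ does (i ≟ j)) ≡ ⟦ f j ⟧
  #-∧-≟ {suc n} f zero = trans
    (cong₂ (λ b k → ⟦ b ⟧ + k) (∧-identityʳ (f zero)) (#-∧-false (f ∘ suc)))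
    (+-identityʳ ⟦ f zero ⟧)
  #-∧-≟ {suc n} f (suc j) = trans
    (cong (λ b → ⟦ b ⟧ + # (λ i → f (suc i) ∧ does (i ≟ j))) (∧-zeroʳ (f zero)))
    (#-∧-≟ (f ∘ suc) j)

  #-∧-≟ˡ : ∀ {n} (b : Bool) (i : Fin n) → # (λ j → b ∧ does (i ≟ j)) ≡ ⟦ b ⟧
  #-∧-≟ˡ     true  i = #-≟ i
  #-∧-≟ˡ {n} false i = #-false n

split : ∀ {n a b} → n ≡ a + b → Fin n ↔ (Fin a ⊎ Fin b)
split refl = +↔⊎

opaque
  unfolding #

  #-splitAt : ∀ a {b} (f : Fin a ⊎ Fin b → Bool) →
              # (f ∘ splitAt a) ≡ # (f ∘ inj₁) + # (f ∘ inj₂)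
  #-splitAt zero    f = refl
  #-splitAt (suc a) f = trans
    (cong (⟦ f (inj₁ zero) ⟧ +_) (#-splitAt a (f ∘ map suc id)))
    (sym (+-assoc ⟦ f (inj₁ zero) ⟧ _ _))

#-split : ∀ {n a b} (e : n ≡ a + b) (f : Fin a ⊎ Fin b → Bool) →
          # (f ∘ Inverse.to (split e)) ≡ # (f ∘ inj₁) + # (f ∘ inj₂)
#-split {a = a} refl f = #-splitAt a f

-- Pigeonhole arguments.

injection-into-image : ∀ {a b} {X : Set} {f : Fin a → X} (g : Fin b → X) →
                       Injective _≡_ _≡_ f → (∀ i → ∃ λ x → f i ≡ g x) → a ≤ b
injection-into-image {f = f} g f-inj h = injective⇒≤ {f = proj₁ ∘ h} λ {i} {j} e →
  f-inj (trans (proj₂ (h i)) (trans (cong g e) (sym (proj₂ (h j)))))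

injective⇒surjective : ∀ {n} {f : Fin n → Fin n} → Injective _≡_ _≡_ f →
                       ∀ y → ∃ λ x → f x ≡ y
injective⇒surjective {n} {f} f-inj y with any? (λ x → f x ≟ y)
... | yes p = p
... | no ¬p = contradiction (injective⇒≤ {f = g} g-inj) 1+n≰n
  where
  g : Fin (suc n) → Fin n
  g zero    = y
  g (suc i) = f i
  g-inj : Injective _≡_ _≡_ g
  g-inj {zero}  {zero}  e = refl
  g-inj {zero}  {suc j} e = contradiction (j , sym e) ¬p
  g-inj {suc i} {zero}  e = contradiction (i , e) ¬p
  g-inj {suc i} {suc j} e = cong suc (f-inj e)

-- Index set of the overfull counts in both parities: positions `g i` of the first class with
-- positions 0 and 1 of the second. `g` is `suc` where position 0 of the first class must be left
-- out, otherwise `id`.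
two-and : ∀ {a b q} → (Fin a → Fin b) → Fin (2 + a) → Fin b ⊎ Fin (2 + q)
two-and g zero          = inj₂ zero
two-and g (suc zero)    = inj₂ (suc zero)
two-and g (suc (suc i)) = inj₁ (g i)

two-and-injective : ∀ {a b q} {g : Fin a → Fin b} → Injective _≡_ _≡_ g →
                    Injective _≡_ _≡_ (two-and {q = q} g)
two-and-injective g-inj {zero}        {zero}        e = refl
two-and-injective g-inj {suc zero}    {suc zero}    e = refl
two-and-injective g-inj {suc (suc i)} {suc (suc j)} e = cong (λ k → suc (suc k)) (g-inj (inj₁-injective e))
two-and-injective g-inj {zero}        {suc zero}    ()
two-and-injective g-inj {suc zero}    {zero}        ()

-- From tensors to set arrays, and from layers to Latin squares.

record LatinIn {R C S : Set} (T : R → C → S → Bool) (M : R → C → S) : Set where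
  field
    fits     : ∀ r c → T r c (M r c) ≡ true
    row-inj  : ∀ r → Injective _≡_ _≡_ (M r)
    col-inj  : ∀ c → Injective _≡_ _≡_ (λ r → M r c)
    -- A field, since the abstract `R`, `C`, `S` carry no finiteness from which to derive it.
    row-surj : ∀ r s → ∃ λ c → M r c ≡ s

module _ {n k : ℕ} {R C S : Set} (ρ : Fin n ↔ R) (γ : Fin n ↔ C) (σ : Fin n ↔ S)
         (T : R → C → S → Bool) where

  private
    module ρ = Inverse ρ
    module γ = Inverse γ
    module σ = Inverse σ

  -- Each layer of the array read off from `T` is a Latin square inside `T`, and a layering covers
  -- every entry; so one entry that no Latin square uses rules out all layerings.
  nonlayerable :
    (∀ r c → # (T r c ∘ σ.to) ≡ k) →
    (∀ r s → # ((λ c → T r c s) ∘ γ.to) ≡ k) →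
    (∀ c s → # ((λ r → T r c s) ∘ ρ.to) ≡ k) →
    ∀ r₀ c₀ s₀ → T r₀ c₀ s₀ ≡ true → (∀ M → LatinIn T M → M r₀ c₀ ≢ s₀) →
    Σ (SetArray n 2 k) λ A → ¬ Layerable A
  nonlayerable size row col r₀ c₀ s₀ t₀ avoid = A , ¬layerable
    where
    cell : Cell n 2 → Fin n → Bool
    cell (r ∷ c ∷ []) s = T (ρ.to r) (γ.to c) (σ.to s)

    A : SetArray n 2 k
    A .entry c = tabulate (cell c)
    A .entry-size (r ∷ c ∷ []) = trans (∣tabulate∣ _) (size _ _)
    A .line-count zero (r ∷ c ∷ []) s =
      trans (cong ∣_∣ (tabulate-cong λ j → lookup∘tabulate (cell (j ∷ c ∷ [])) s))
        (trans (∣tabulate∣ (λ j → cell (j ∷ c ∷ []) s)) (col _ _))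
    A .line-count (suc zero) (r ∷ c ∷ []) s =
      trans (cong ∣_∣ (tabulate-cong λ j → lookup∘tabulate (cell (r ∷ j ∷ [])) s))
        (trans (∣tabulate∣ (λ j → cell (r ∷ j ∷ []) s)) (row _ _))

    cell-from : ∀ r c s → cell (ρ.from r ∷ γ.from c ∷ []) s ≡ T r c (σ.to s)
    cell-from r c s = cong₂ (λ x y → T x y (σ.to s)) (ρ.strictlyInverseˡ r) (γ.strictlyInverseˡ c)

    to-injective : ∀ {X : Set} (e : Fin n ↔ X) → Injective _≡_ _≡_ (Inverse.to e)
    to-injective e {x} {y} p = trans (sym (Inverse.strictlyInverseʳ e x))
      (trans (cong (Inverse.from e) p) (Inverse.strictlyInverseʳ e y))

    from-injective : ∀ {X : Set} (e : Fin n ↔ X) → Injective _≡_ _≡_ (Inverse.from e)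
    from-injective e {x} {y} p = trans (sym (Inverse.strictlyInverseˡ e x))
      (trans (cong (Inverse.to e) p) (Inverse.strictlyInverseˡ e y))

    latin : ∀ {L} → IsLayer A L → LatinIn T (λ r c → σ.to (L (ρ.from r ∷ γ.from c ∷ [])))
    latin {L} layer = record
      { fits     = λ r c → let x = ρ.from r ∷ γ.from c ∷ [] in
          trans (sym (cell-from r c (L x)))
            (trans (sym (lookup∘tabulate (cell x) (L x))) ([]=⇒lookup (chosen-from-entry x)))
      ; row-inj  = λ r → from-injective γ ∘ row-inj (ρ.from r) ∘ to-injective σ
      -- `r₀` only fills the coordinate that `line` overwrites; `c₀` does the same in `row-inj`.
      ; col-inj  = λ c → from-injective ρ ∘ line-injective zero (ρ.from r₀ ∷ γ.from c ∷ []) ∘ to-injective σ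
      ; row-surj = λ r s → let j , e = injective⇒surjective (row-inj (ρ.from r)) (σ.from s) in
          γ.to j , trans (cong (λ y → σ.to (L (ρ.from r ∷ y ∷ []))) (γ.strictlyInverseʳ j))
                     (trans (cong σ.to e) (σ.strictlyInverseˡ s))
      }
      where
      open IsLayer layer
      row-inj : ∀ r → Injective _≡_ _≡_ (λ c → L (r ∷ c ∷ []))
      row-inj r = line-injective (suc zero) (r ∷ γ.from c₀ ∷ [])

    ¬layerable : ¬ Layerable A
    ¬layerable (L , layers , covers) =
      let x = ρ.from r₀ ∷ γ.from c₀ ∷ []
          t , e , _ = covers x (σ.from s₀) (lookup⇒[]= _ _
            (trans (lookup∘tabulate (cell x) (σ.from s₀))
              (trans (cell-from r₀ c₀ (σ.from s₀))
                (trans (cong (T r₀ c₀) (σ.strictlyInverseˡ s₀)) t₀))))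
      in avoid _ (latin (layers t)) (trans (cong σ.to e) (σ.strictlyInverseˡ s₀))

-- Even order, `n = m + m`.

module Even (p : ℕ) where

  m = 2 + p

  -- V k is a column of m cells with symbol 0 in row k and symbol 1 in all other rows.
  V : Fin m → Fin m → Fin (suc m) → Bool
  V k i zero          = does (i ≟ k)
  V k i (suc zero)    = not (does (i ≟ k))
  V k i (suc (suc _)) = false

  -- Columns V (h j) side by side form a square having its zeros in row 0, except that the
  -- zero of column 0 is in row 1. A Latin square of order m cannot have pairwise distinct
  -- symbols in these m cells.
  h : Fin m → Fin m
  h zero    = suc zero
  h (suc _) = zero

  -- In the two mixed blocks a cell holds all `m - 1` symbols `inj₂ _` and a single `inj₁ _`; in the
  -- other two it holds `m` of the `m + 1` symbols `inj₁ _`. Complementing `V` between neighbouring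
  -- blocks makes every line sum `m`.
  T : Fin m ⊎ Fin m → Fin m ⊎ Fin m → Fin (suc m) ⊎ Fin (suc p) → Bool
  T (inj₁ i) (inj₁ j) (inj₁ s) = not (V zero i s)
  T (inj₁ i) (inj₁ j) (inj₂ s) = false
  T (inj₁ i) (inj₂ j) (inj₁ s) = V zero i s
  T (inj₁ i) (inj₂ j) (inj₂ s) = true
  T (inj₂ i) (inj₁ j) (inj₁ s) = V (h j) i s
  T (inj₂ i) (inj₁ j) (inj₂ s) = true
  T (inj₂ i) (inj₂ j) (inj₁ s) = not (V (h j) i s)
  T (inj₂ i) (inj₂ j) (inj₂ s) = false

  opaque
    unfolding #

    V-unique : ∀ k i → # (V k i) ≡ 1
    V-unique k i with does (i ≟ k)
    ... | true  = cong suc (#-false p)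
    ... | false = cong suc (#-false p)

  -- Moving the zero to another row keeps the column counts, so below `V zero` any `V (h j)` may
  -- stand.
  V-column : ∀ k l s → # (λ i → V k i s) ≡ # (λ i → V l i s)
  V-column k l zero          = trans (#-∧-≟ (λ _ → true) k) (sym (#-∧-≟ (λ _ → true) l))
  V-column k l (suc zero)    = trans (#-not-unique _ (#-∧-≟ (λ _ → true) k))
                                 (sym (#-not-unique _ (#-∧-≟ (λ _ → true) l)))
  V-column k l (suc (suc _)) = refl

  size : ∀ r c → # (T r c ∘ inj₁) + # (T r c ∘ inj₂) ≡ m
  size (inj₁ i) (inj₁ j) = trans
    (cong₂ _+_ (#-not-unique (V zero i) (V-unique zero i)) (#-false (suc p)))
    (+-identityʳ m)
  size (inj₁ i) (inj₂ j) = cong₂ _+_ (V-unique zero i) (#-true (suc p))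
  size (inj₂ i) (inj₁ j) = cong₂ _+_ (V-unique (h j) i) (#-true (suc p))
  size (inj₂ i) (inj₂ j) = trans
    (cong₂ _+_ (#-not-unique (V (h j) i) (V-unique (h j) i)) (#-false (suc p)))
    (+-identityʳ m)

  row : ∀ r s → # (λ c → T r (inj₁ c) s) + # (λ c → T r (inj₂ c) s) ≡ m
  row (inj₁ i) (inj₁ s) = #-not {m} (λ _ → V zero i s)
  row (inj₁ i) (inj₂ s) = cong₂ _+_ (#-false m) (#-true m)
  row (inj₂ i) (inj₁ s) = trans (+-comm (# {m} (λ c → V (h c) i s)) _) (#-not (λ c → V (h c) i s))
  row (inj₂ i) (inj₂ s) = trans (cong₂ _+_ (#-true m) (#-false m)) (+-identityʳ m)

  col : ∀ c s → # (λ r → T (inj₁ r) c s) + # (λ r → T (inj₂ r) c s) ≡ m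
  col (inj₁ j) (inj₁ s) = trans (cong (# {m} (λ i → not (V zero i s)) +_) (V-column (h j) zero s))
                            (#-not (λ i → V zero i s))
  col (inj₁ j) (inj₂ s) = cong₂ _+_ (#-false m) (#-true m)
  col (inj₂ j) (inj₁ s) = trans (+-comm (# {m} (λ i → V zero i s)) _)
                            (trans (cong (# {m} (λ i → not (V (h j) i s)) +_) (V-column zero (h j) s))
                              (#-not (λ i → V (h j) i s)))
  col (inj₂ j) (inj₂ s) = trans (cong₂ _+_ (#-true m) (#-false m)) (+-identityʳ m)

  -- The entry `given` would force symbols `inj₂ _` into all `m` cells of row `inj₂ zero` in the
  -- columns `inj₁ _`, but only `m - 1` such symbols exist.
  avoid : ∀ M → LatinIn T M → M (inj₂ (suc zero)) (inj₁ zero) ≢ inj₁ zero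
  avoid M latin given = 1+n≰n (injection-into-image inj₂ (inj₁-injective ∘ row-inj (inj₂ zero)) row-high)
    where
    open LatinIn latin

    -- The `m` upper cells of column `inj₁ zero` take symbols `inj₁ _` only; with `given` and the
    -- corner the column would need `m + 2` of these `m + 1` symbols.
    corner-high : ∀ s → M (inj₂ zero) (inj₁ zero) ≢ inj₁ s
    corner-high s e = 1+n≰n (injection-into-image inj₁
      (two-and-injective {g = id} id ∘ col-inj (inj₁ zero)) low)
      where
      low : ∀ i → ∃ λ x → M (two-and id i) (inj₁ zero) ≡ inj₁ x
      low zero          = s , e
      low (suc zero)    = zero , given
      low (suc (suc i)) with M (inj₁ i) (inj₁ zero) | fits (inj₁ i) (inj₁ zero)
      ... | inj₁ x | _ = x , refl

    -- `V zero` has its zero in row 0 only, so each row `inj₁ (suc i)` has symbol 0 in a column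
    -- `inj₁ _`. With rows 0 and 1 of the lower half, `m + 1` rows would share `m` columns.
    later-columns-nonzero : ∀ j → M (inj₂ zero) (inj₁ (suc j)) ≢ inj₁ zero
    later-columns-nonzero j e = 1+n≰n (injection-into-image inj₁ place-injective (λ i → proj₁ (place i) , refl))
      where
      place : ∀ i → ∃ λ x → M (two-and suc i) (inj₁ x) ≡ inj₁ zero
      place zero          = suc j , e
      place (suc zero)    = zero , given
      place (suc (suc i)) with row-surj (inj₁ (suc i)) (inj₁ zero)
      ... | inj₁ x , q = x , q
      ... | inj₂ x , q with M (inj₁ (suc i)) (inj₂ x) | fits (inj₁ (suc i)) (inj₂ x)
      place (suc (suc i)) | inj₂ x , refl | _ | ()
      place-injective : Injective _≡_ _≡_ (λ i → inj₁ {B = Fin m} (proj₁ (place i)))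
      place-injective {i} {k} q = two-and-injective {g = suc} suc-injective
        (col-inj (inj₁ (proj₁ (place k)))
          (trans (cong (M (two-and suc i)) (sym q)) (trans (proj₂ (place i)) (sym (proj₂ (place k))))))

    -- The only `inj₁ _` symbol that `T` offers here is 1 in column 0 and 0 in the other columns.
    row-high : ∀ j → ∃ λ x → M (inj₂ zero) (inj₁ j) ≡ inj₂ x
    row-high j with M (inj₂ zero) (inj₁ j) in e | fits (inj₂ zero) (inj₁ j)
    row-high j       | inj₂ x    | _ = x , refl
    row-high zero    | inj₁ x    | _ = ⊥-elim (corner-high x e)
    row-high (suc j) | inj₁ zero | _ = ⊥-elim (later-columns-nonzero j e)
    row-high (suc j) | inj₁ (suc zero) | ()
    row-high (suc j) | inj₁ (suc (suc _)) | ()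

  construction : ∀ {n} → n ≡ m + m → Σ (SetArray n 2 m) λ A → ¬ Layerable A
  construction e = nonlayerable (split e) (split e) (split e′) T
    (λ r c → trans (#-split e′ (T r c)) (size r c))
    (λ r s → trans (#-split e (λ c → T r c s)) (row r s))
    (λ c s → trans (#-split e (λ r → T r c s)) (col c s))
    (inj₂ (suc zero)) (inj₁ zero) (inj₁ zero) refl avoid
    where
    e′ = trans e (+-suc m (suc p))

-- Multiples in a window of consecutive integers, and exchanging two indices.

opaque
  unfolding #

  #-last : ∀ n (g : ℕ → Bool) → # {suc n} (g ∘ toℕ) ≡ # {n} (g ∘ toℕ) + ⟦ g n ⟧
  #-last zero    g = +-comm ⟦ g 0 ⟧ 0
  #-last (suc n) g = trans (cong (⟦ g 0 ⟧ +_) (#-last n (g ∘ suc))) (sym (+-assoc ⟦ g 0 ⟧ _ _))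

  #-shift : ∀ n (g : ℕ → Bool) → (∀ y → g (n + y) ≡ g y) → ∀ x →
            # {n} (λ z → g (x + toℕ z)) ≡ # {n} (g ∘ toℕ)
  #-shift n g periodic zero    = refl
  #-shift n g periodic (suc x) = trans
    (#-shift n (g ∘ suc) (λ y → trans (cong g (sym (+-suc n y))) (periodic (suc y))) x)
    -- Moving the window by one loses `g 0` and gains `g n`, which agree by periodicity: both sides
    -- come from the sum of length `suc n`, split at its first or last term.
    (+-cancelˡ-≡ ⟦ g 0 ⟧ _ _ (trans (#-last n g) (trans
      (cong (λ b → # {n} (g ∘ toℕ) + ⟦ b ⟧) (trans (cong g (sym (+-identityʳ n))) (periodic 0)))
      (+-comm _ ⟦ g 0 ⟧))))

multiple? : ℕ → ℕ → Bool
multiple? k x = x % suc k ≡ᵇ 0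

opaque
  unfolding #

  #-multiple : ∀ k x → # {suc k} (λ z → multiple? k (x + toℕ z)) ≡ 1
  #-multiple k x = trans (#-shift (suc k) (multiple? k) periodic x)
    (cong suc (trans (#-cong {k} λ z → cong (_≡ᵇ 0) (m<n⇒m%n≡m {n = suc k} (toℕ<n (suc z)))) (#-false k)))
    where
    periodic : ∀ y → multiple? k (suc k + y) ≡ multiple? k y
    periodic y = cong (_≡ᵇ 0) (trans (cong (_% suc k) (+-comm (suc k) y)) ([m+n]%n≡m%n y (suc k)))

-- Matching on the index first lets `exchange (suc (suc i)) b` reduce for unknown `b`, as
-- `D-exchange` and `column-low` require.
exchange : ∀ {q} → Fin (2 + q) → Bool → Fin (2 + q)
exchange zero          b = if b then suc zero else zero
exchange (suc zero)    b = if b then zero else suc zero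
exchange (suc (suc i)) b = suc (suc i)

opaque
  unfolding #

  #-exchange : ∀ {q} (b : Bool) (f : Fin (2 + q) → Bool) → # (λ i → f (exchange i b)) ≡ # f
  #-exchange false f = refl
  #-exchange true  f = trans (sym (+-assoc ⟦ f (suc zero) ⟧ ⟦ f zero ⟧ rest))
    (trans (cong (_+ rest) (+-comm ⟦ f (suc zero) ⟧ ⟦ f zero ⟧)) (+-assoc ⟦ f zero ⟧ ⟦ f (suc zero) ⟧ rest))
    where
    rest : ℕ
    rest = # (λ i → f (suc (suc i)))

-- Odd order, `n = m + N` with `N = m + 1`.

module Odd (p : ℕ) where

  m = 2 + p
  N = 3 + p

  -- Symmetric in its arguments: each two of them determine the third.
  D : Fin N → Fin N → Fin N → Bool
  D i j k = multiple? m (toℕ i + toℕ j + toℕ k)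

  same : Fin N → Fin N → Bool → Bool
  same r c b = does (exchange r b ≟ c)

  -- A Latin square inside T has exactly one entry of the block inj₂ × inj₂ × inj₂ in each of the rows,
  -- columns and symbols inj₂ _. With D alone that block would consist of the entries
  -- (i, i, s); two of them, (0, 0, 1) and (1, 1, 1), are exchanged for (0, 1, 1) and
  -- (1, 0, 1), which would have to be used together although they share the symbol 1.
  T : Fin m ⊎ Fin N → Fin m ⊎ Fin N → Fin m ⊎ Fin N → Bool
  T (inj₁ i) (inj₁ j) (inj₁ s) = true
  T (inj₁ i) (inj₁ j) (inj₂ s) = false
  T (inj₁ i) (inj₂ j) (inj₁ s) = false
  T (inj₁ i) (inj₂ j) (inj₂ s) = not (D (suc i) j s)
  T (inj₂ i) (inj₁ j) (inj₁ s) = false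
  T (inj₂ i) (inj₁ j) (inj₂ s) = not (D (suc j) i s)
  T (inj₂ i) (inj₂ j) (inj₁ s) = not (same i j (does (zero ≟ s)))
  T (inj₂ i) (inj₂ j) (inj₂ s) = not (D zero i s) ∧ same i j (does (suc zero ≟ s))

  #-D₁ : ∀ j k → # (λ i → not (D i j k)) ≡ m
  #-D₁ j k = #-not-unique _ (trans
    (#-cong λ i → cong (multiple? m) (trans (+-assoc (toℕ i) _ _) (+-comm (toℕ i) _)))
    (#-multiple m (toℕ j + toℕ k)))

  #-D₂ : ∀ i k → # (λ j → not (D i j k)) ≡ m
  #-D₂ i k = #-not-unique _ (trans
    (#-cong λ j → cong (multiple? m) (trans (+-assoc (toℕ i) _ _)
      (trans (cong (toℕ i +_) (+-comm (toℕ j) _)) (sym (+-assoc (toℕ i) _ _)))))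
    (#-multiple m (toℕ i + toℕ k)))

  #-D₃ : ∀ i j → # (λ k → not (D i j k)) ≡ m
  #-D₃ i j = #-not-unique _ (#-multiple m (toℕ i + toℕ j))

  -- Only symbol 1 moves anything, and neither 0 + 1 nor 1 + 1 is a multiple of `N`, as `N ≥ 3`.
  -- This lets `col` reindex its rows by the exchange.
  D-exchange : ∀ r s → D zero (exchange r (does (suc zero ≟ s))) s ≡ D zero r s
  D-exchange zero          zero          = refl
  D-exchange zero          (suc zero)    = refl
  D-exchange zero          (suc (suc s)) = refl
  D-exchange (suc zero)    zero          = refl
  D-exchange (suc zero)    (suc zero)    = refl
  D-exchange (suc zero)    (suc (suc s)) = refl
  D-exchange (suc (suc r)) s             = refl

  opaque
    unfolding #

    -- Without the exchanges both counts are `m` on the diagonal and 0 off it. In the cells with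
    -- indices 0 and 1, exchanging symbol `inj₂ (suc zero)` changes the left count by one, and
    -- exchanging `inj₁ zero` changes the right one equally.
    same-symbols : ∀ r c → # (λ s → not (D zero r s) ∧ same r c (does (suc zero ≟ s)))
                         ≡ # {m} (λ s → same r c (does (zero ≟ s)))
    same-symbols zero zero = trans
      (#-∧-true {suc p} (λ s → not (D zero zero (suc (suc s)))))
      (trans (ℕ-suc-injective (#-D₃ zero zero)) (sym (#-true (suc p))))
    same-symbols zero (suc zero) = cong suc (trans
      (#-∧-false {suc p} (λ s → not (D zero zero (suc (suc s)))))
      (sym (#-false (suc p))))
    same-symbols zero (suc (suc c)) = trans
      (#-∧-false {suc p} (λ s → not (D zero zero (suc (suc s)))))
      (sym (#-false (suc p)))
    same-symbols (suc zero) zero = cong suc (trans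
      (#-∧-false {suc p} (λ s → not (D zero (suc zero) (suc (suc s)))))
      (sym (#-false (suc p))))
    same-symbols (suc zero) (suc zero) =
      trans (cong suc (#-∧-true {suc p} (λ s → not (D zero (suc zero) (suc (suc s))))))
        (trans (ℕ-suc-injective (#-D₃ zero (suc zero))) (sym (#-true (suc p))))
    same-symbols (suc zero) (suc (suc c)) = trans
      (#-∧-false {suc p} (λ s → not (D zero (suc zero) (suc (suc s)))))
      (sym (#-false (suc p)))
    same-symbols (suc (suc r)) c with does (suc (suc r) ≟ c)
    ... | true  = trans (#-∧-true (λ s → not (D zero (suc (suc r)) s)))
                    (trans (#-D₃ zero (suc (suc r))) (sym (#-true m)))
    ... | false = trans (#-∧-false (λ s → not (D zero (suc (suc r)) s))) (sym (#-false m))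

  size : ∀ r c → # (T r c ∘ inj₁) + # (T r c ∘ inj₂) ≡ m
  size (inj₁ i) (inj₁ j) = trans (cong₂ _+_ (#-true m) (#-false N)) (+-identityʳ m)
  size (inj₁ i) (inj₂ j) = cong₂ _+_ (#-false m) (#-D₃ (suc i) j)
  size (inj₂ i) (inj₁ j) = cong₂ _+_ (#-false m) (#-D₃ (suc j) i)
  size (inj₂ i) (inj₂ j) = trans (cong (# {m} (λ s → not (same i j (does (zero ≟ s)))) +_) (same-symbols i j))
    (#-not (λ s → same i j (does (zero ≟ s))))

  row : ∀ r s → # (λ c → T r (inj₁ c) s) + # (λ c → T r (inj₂ c) s) ≡ m
  row (inj₁ i) (inj₁ s) = trans (cong₂ _+_ (#-true m) (#-false N)) (+-identityʳ m)
  row (inj₁ i) (inj₂ s) = cong₂ _+_ (#-false m) (#-D₂ (suc i) s)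
  row (inj₂ i) (inj₁ s) = cong₂ _+_ (#-false m)
    (#-not-unique {m} (λ c → same i c b) (#-≟ (exchange i b)))
    where b = does (zero ≟ s)
  row (inj₂ i) (inj₂ s) = trans (+-comm (# {m} (λ c → not (D (suc c) i s))) _)
    (trans (cong (_+ # {m} (λ c → not (D (suc c) i s))) (#-∧-≟ˡ (not (D zero i s)) (exchange i b)))
      -- `D zero` from the columns `inj₂ _` and `D (suc c)` from the columns `inj₁ _` together run
      -- over the whole first argument of `D`.
      (trans (sym (#-suc (λ k → not (D k i s)))) (#-D₁ i s)))
    where b = does (suc zero ≟ s)

  col : ∀ c s → # (λ r → T (inj₁ r) c s) + # (λ r → T (inj₂ r) c s) ≡ m
  col (inj₁ j) (inj₁ s) = trans (cong₂ _+_ (#-true m) (#-false N)) (+-identityʳ m)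
  col (inj₁ j) (inj₂ s) = cong₂ _+_ (#-false m) (#-D₂ (suc j) s)
  col (inj₂ j) (inj₁ s) = cong₂ _+_ (#-false m)
    (#-not-unique {m} (λ r → same r j b)
      (trans (#-exchange b (λ r → does (r ≟ j))) (#-∧-≟ (λ _ → true) j)))
    where b = does (zero ≟ s)
  col (inj₂ j) (inj₂ s) = trans (+-comm (# {m} (λ r → not (D (suc r) j s))) _)
    (trans (cong (_+ # {m} (λ r → not (D (suc r) j s)))
      (trans (#-cong {N} (λ r → cong (λ d → not d ∧ same r j b) (sym (D-exchange r s))))
        (trans (#-exchange b (λ r → not (D zero r s) ∧ does (r ≟ j)))
          (#-∧-≟ (λ r → not (D zero r s)) j))))
      (trans (sym (#-suc (λ k → not (D k j s)))) (#-D₁ j s)))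
    where b = does (suc zero ≟ s)

  -- The entry `given` would force symbols `inj₁ _` into all `N` lower cells of column `inj₂ zero`,
  -- but only `m` such symbols exist.
  avoid : ∀ M → LatinIn T M → M (inj₂ zero) (inj₂ (suc zero)) ≢ inj₂ (suc zero)
  avoid M latin given = 1+n≰n (injection-into-image inj₁ (inj₂-injective ∘ col-inj (inj₂ zero)) column-low)
    where
    open LatinIn latin

    -- Row `inj₂ zero` takes only symbols `inj₂ _` in its `m` columns `inj₁ _`; `given` and the
    -- corner would bring these to `m + 2`, above `N`.
    corner-low : ∀ s → M (inj₂ zero) (inj₂ zero) ≢ inj₂ s
    corner-low s e = 1+n≰n (injection-into-image inj₂
      (two-and-injective {g = id} id ∘ row-inj (inj₂ zero)) high)
      where
      high : ∀ j → ∃ λ x → M (inj₂ zero) (two-and id j) ≡ inj₂ x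
      high zero          = s , e
      high (suc zero)    = suc zero , given
      high (suc (suc j)) with M (inj₂ zero) (inj₁ j) | fits (inj₂ zero) (inj₁ j)
      ... | inj₂ x | _ = x , refl

    -- The `m` rows `inj₁ _` have this symbol in columns `inj₂ _`; `given` and its mirror image
    -- would make `m + 2` rows share `N` columns.
    mirror-not-1 : M (inj₂ (suc zero)) (inj₂ zero) ≢ inj₂ (suc zero)
    mirror-not-1 e = 1+n≰n (injection-into-image inj₂ place-injective (λ i → proj₁ (place i) , refl))
      where
      place : ∀ i → ∃ λ x → M (two-and id i) (inj₂ x) ≡ inj₂ (suc zero)
      place zero          = suc zero , given
      place (suc zero)    = zero , e
      place (suc (suc i)) with row-surj (inj₁ i) (inj₂ (suc zero))
      ... | inj₂ x , q = x , q
      ... | inj₁ x , q with M (inj₁ i) (inj₁ x) | fits (inj₁ i) (inj₁ x)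
      place (suc (suc i)) | inj₁ x , refl | _ | ()
      place-injective : Injective _≡_ _≡_ (λ i → inj₂ {A = Fin m} (proj₁ (place i)))
      place-injective {i} {k} q = two-and-injective {g = id} id
        (col-inj (inj₂ (proj₁ (place k)))
          (trans (cong (M (two-and id i)) (sym q)) (trans (proj₂ (place i)) (sym (proj₂ (place k))))))

    column-low : ∀ r → ∃ λ x → M (inj₂ r) (inj₂ zero) ≡ inj₁ x
    column-low r with M (inj₂ r) (inj₂ zero) in e | fits (inj₂ r) (inj₂ zero)
    column-low r             | inj₁ x             | _ = x , refl
    column-low zero          | inj₂ x             | _ = ⊥-elim (corner-low x e)
    column-low (suc zero)    | inj₂ (suc zero)    | _ = ⊥-elim (mirror-not-1 e)
    column-low (suc zero)    | inj₂ zero          | ()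
    -- `D` does not reduce at a variable symbol, so the false second conjunct gives the
    -- contradiction.
    column-low (suc zero)    | inj₂ (suc (suc x)) | t = contradiction (trans (sym t) (∧-zeroʳ _)) λ ()
    column-low (suc (suc r)) | inj₂ x             | t = contradiction (trans (sym t) (∧-zeroʳ _)) λ ()

  construction : ∀ {n} → n ≡ m + N → Σ (SetArray n 2 m) λ A → ¬ Layerable A
  construction e = nonlayerable (split e) (split e) (split e) T
    (λ r c → trans (#-split e (T r c)) (size r c))
    (λ r s → trans (#-split e (λ c → T r c s)) (row r s))
    (λ c s → trans (#-split e (λ r → T r c s)) (col c s))
    (inj₂ zero) (inj₂ (suc zero)) (inj₂ (suc zero)) refl avoid

-- Assembling the two parities.

⌈n/2⌉-cases : ∀ n → ⌈ n /2⌉ ≡ ⌊ n /2⌋ ⊎ ⌈ n /2⌉ ≡ suc ⌊ n /2⌋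
⌈n/2⌉-cases zero          = inj₁ refl
⌈n/2⌉-cases (suc zero)    = inj₂ refl
⌈n/2⌉-cases (suc (suc n)) with ⌈n/2⌉-cases n
... | inj₁ e = inj₁ (cong suc e)
... | inj₂ e = inj₂ (cong suc e)

-- Keeping both halves as variables lets `refl` identify them and `k` be matched as `2 + p`.
near-half : ∀ {n k l} → 2 ≤ k → n ≡ k + l → l ≡ k ⊎ l ≡ suc k →
            Σ (SetArray n 2 k) λ A → ¬ Layerable A
near-half {k = suc (suc p)} _           e (inj₁ refl) = Even.construction p e
near-half {k = suc (suc p)} _           e (inj₂ refl) = Odd.construction p e
near-half {k = suc zero}    (s≤s ())

theorem8 : (n : ℕ) → n ≥ 5 → Σ (SetArray n 2 ⌊ n /2⌋) λ A → ¬ Layerable A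
theorem8 n n≥5 = near-half (⌊n/2⌋-mono n≥5) (sym (⌊n/2⌋+⌈n/2⌉≡n n)) (⌈n/2⌉-cases n)
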